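{- Let $\mathcal{E}$ be the class of Kalmár elementary functions. Then $$\langle x+1,\ x\bmod y,\ 2^x\rangle\subsetneqq\mathcal{E}.$$
   Context: $\mathbb{N}$ is the set of non-negative integers. An ($r$-ary, $r\ge 1$) operation on $\mathbb{N}$ is a function $\mathbb{N}^r\to\mathbb{N}$. Truncated subtraction is $x \mathbin{\dot- } y:=\max(x-y,0)$. Conventions: $\lfloor x/0\rfloor:=0$, and $x\bmod y:=x \mathbin{\dot- } y\lfloor x/y\rfloor$, so that $x\bmod 0=x$. A set $S$ of operations on $\mathbb{N}$ is closed under substitution if, whenever $f\in S$ is $r$-ary and $g_1,\dots,g_r\in S$ are $n$-ary, the operation $\vec x\mapsto f(g_1(\vec x),\dots,g_r(\vec x))$ is in $S$. For a set $\mathcal{B}$ of operations on $\mathbb{N}$, $\langle\mathcal{B}\rangle$ denotes the closure under substitution of $\mathcal{B}\cup C\cup P$, where $C$ is the set of all constant operations on $\mathbb{N}$ (of every arity) and $P$ is the set of all projections $(x_1,\dots,x_n)\mapsto x_i$. Here $x+1$ and $2^x$ denote unary operations and $x\bmod y$ a binary operation. The Kalmár elementary functions, forming the class $\mathcal{E}$, are the elements of the smallest set of operations on $\mathbb{N}$ that contains the constants, the projections, the addition, and the truncated subtraction, and that is closed under substitution, bounded summation ($(\vec x,y)\mapsto\sum_{z<y}f(\vec x,z)$), and bounded multiplication ($(\vec x,y)\mapsto\prod_{z<y}f(\vec x,z)$). -}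

module Defs where

open import Data.Fin using (Fin)
open import Data.List using (sum; product; applyUpTo)
open import Data.Nat using (ℕ; zero; suc; _+_; _*_; _∸_; _^_; _/_)
open import Data.Product using (∃-syntax; _×_)
open import Data.Vec using (Vec; []; _∷_; _∷ʳ_; init; last; lookup; tabulate)
open import Relation.Binary.PropositionalEquality using (_≗_)
open import Relation.Nullary using (¬_)

-- Arities are at least 1: Op k is the type of (k + 1)-ary operations.
Op : ℕ → Set
Op k = Vec ℕ (suc k) → ℕ

OpSet : Set₁
OpSet = ∀ {k} → Op k → Set

constant : ∀ {k} → ℕ → Op k
constant c _ = c

projection : ∀ {k} → Fin (suc k) → Op k
projection i x = lookup x i

substitute : ∀ {r n} → Op r → (Fin (suc r) → Op n) → Op n
substitute f g x = f (tabulate (λ i → g i x))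

-- The bound y is the last argument: (x⃗ , y) ↦ Σ_{z < y} f (x⃗ , z).
boundedSum : ∀ {k} → Op k → Op k
boundedSum f v = sum (applyUpTo (λ z → f (init v ∷ʳ z)) (last v))

boundedProduct : ∀ {k} → Op k → Op k
boundedProduct f v = product (applyUpTo (λ z → f (init v ∷ʳ z)) (last v))

⌊_/_⌋ : ℕ → ℕ → ℕ
⌊ x / zero ⌋  = 0
⌊ x / suc y ⌋ = x / suc y

_mod_ : ℕ → ℕ → ℕ
x mod y = x ∸ y * ⌊ x / y ⌋

successor : Op 0
successor (x ∷ []) = x + 1

powerOfTwo : Op 0
powerOfTwo (x ∷ []) = 2 ^ x

addition : Op 1
addition (x ∷ y ∷ []) = x + y

truncatedSubtraction : Op 1
truncatedSubtraction (x ∷ y ∷ []) = x ∸ y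

modulo : Op 1
modulo (x ∷ y ∷ []) = x mod y

-- Operations with the same values are the same operation; without function
-- extensionality this has to be imposed on inductively generated sets, which
-- is the role of the constructor `ext` here and in `Elementary`.
data ⟨_⟩ (B : OpSet) : ∀ {k} → Op k → Set where
  base  : ∀ {k} {f : Op k} → B f → ⟨ B ⟩ f
  const : ∀ {k} (c : ℕ) → ⟨ B ⟩ (constant {k} c)
  proj  : ∀ {k} (i : Fin (suc k)) → ⟨ B ⟩ (projection i)
  subst : ∀ {r n} {f : Op r} {g : Fin (suc r) → Op n} →
          ⟨ B ⟩ f → (∀ i → ⟨ B ⟩ (g i)) → ⟨ B ⟩ (substitute f g)
  ext   : ∀ {k} {f g : Op k} → f ≗ g → ⟨ B ⟩ f → ⟨ B ⟩ g

data Elementary : ∀ {k} → Op k → Set where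
  const : ∀ {k} (c : ℕ) → Elementary (constant {k} c)
  proj  : ∀ {k} (i : Fin (suc k)) → Elementary (projection i)
  add   : Elementary addition
  sub   : Elementary truncatedSubtraction
  subst : ∀ {r n} {f : Op r} {g : Fin (suc r) → Op n} →
          Elementary f → (∀ i → Elementary (g i)) → Elementary (substitute f g)
  bsum  : ∀ {k} {f : Op k} → Elementary f → Elementary (boundedSum f)
  bprod : ∀ {k} {f : Op k} → Elementary f → Elementary (boundedProduct f)
  ext   : ∀ {k} {f g : Op k} → f ≗ g → Elementary f → Elementary g

data SucModExp : ∀ {k} → Op k → Set where
  x+1    : SucModExp successor
  xmody  : SucModExp modulo
  2^x    : SucModExp powerOfTwo

_⊆_ : OpSet → OpSet → Set
A ⊆ B = ∀ {k} {f : Op k} → A f → B f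

-- Properness is witnessed by an explicit operation, which is constructively
-- stronger than ¬ (B ⊆ A) and classically equivalent to it.
_⊊_ : OpSet → OpSet → Set
A ⊊ B = A ⊆ B × (∃[ k ] ∃[ f ] (B {k} f × ¬ A f))

{-# OPTIONS --safe #-}

-- Every operation of ⟨x + 1, x mod y, 2^x⟩ is bounded by a monotone function
-- of a single argument, because x mod y ≤ x; addition is not so bounded.

module Submission where

open import Data.Fin using (zero; suc)
open import Data.List using (applyUpTo)
open import Data.Nat
open import Data.Nat.DivMod using (m/n≤m; m/n*n≤m; /-monoˡ-≤; m*n/n≡m)
open import Data.Nat.ListAction using (sum; product)
open import Data.Nat.Properties
open import Data.Product using (∃-syntax; _×_; _,_)
open import Data.Vec using (_∷_; []; lookup)
open import Data.Vec.Properties using (lookup∘tabulate)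
open import Function using (_∘_)
open import Relation.Binary.Definitions using (Monotonic₁)
open import Relation.Binary.PropositionalEquality using (_≡_; refl; sym; trans; cong; cong₂)
open import Relation.Nullary using (¬_)

open import Defs

-- Properness is a matter of growth: no generator combines the sizes of two arguments, and
-- domination by a monotone function of one argument survives substitution, whereas `addition` grows
-- in each argument separately. For the inclusion only x mod y takes work: x / y is obtained as a
-- bounded sum counting the positive multiples of y up to x, and truncated subtraction then gives
-- the remainder.

BoundedByOneArgument : OpSet
BoundedByOneArgument {k} f =
  ∃[ i ] ∃[ h ] (Monotonic₁ _≤_ _≤_ h × (∀ v → f v ≤ h (lookup v i)))

x-mod-y≤x : ∀ x y → x mod y ≤ x
x-mod-y≤x x y = m∸n≤m x (y * ⌊ x / y ⌋)

⟨SucModExp⟩⇒BoundedByOneArgument : ⟨ SucModExp ⟩ ⊆ BoundedByOneArgument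
⟨SucModExp⟩⇒BoundedByOneArgument (base x+1) =
  zero , (_+ 1) , +-monoˡ-≤ 1 , λ { (x ∷ []) → ≤-refl }
⟨SucModExp⟩⇒BoundedByOneArgument (base xmody) =
  zero , (λ x → x) , (λ x≤y → x≤y) , λ { (x ∷ y ∷ []) → x-mod-y≤x x y }
⟨SucModExp⟩⇒BoundedByOneArgument (base 2^x) =
  zero , (2 ^_) , ^-monoʳ-≤ 2 , λ { (x ∷ []) → ≤-refl }
⟨SucModExp⟩⇒BoundedByOneArgument (const c) =
  zero , (λ _ → c) , (λ _ → ≤-refl) , λ _ → ≤-refl
⟨SucModExp⟩⇒BoundedByOneArgument (proj i) =
  i , (λ x → x) , (λ x≤y → x≤y) , λ _ → ≤-refl
⟨SucModExp⟩⇒BoundedByOneArgument (subst {g = g} f∈ g∈)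
  with i , h , h-mono , f≤h ← ⟨SucModExp⟩⇒BoundedByOneArgument f∈
  with j , h′ , h′-mono , gᵢ≤h′ ← ⟨SucModExp⟩⇒BoundedByOneArgument (g∈ i) =
  -- Only the inner operation at the position `i` that bounds `f` matters: f (g v) ≤ h (gᵢ v) ≤ h
  -- (h′ (vⱼ)), the second step by monotonicity of `h`.
  j , h ∘ h′ , h-mono ∘ h′-mono , λ v →
    ≤-trans (f≤h _)
      (h-mono (≤-trans (≤-reflexive (lookup∘tabulate (λ i → g i v) i)) (gᵢ≤h′ v)))
⟨SucModExp⟩⇒BoundedByOneArgument (ext f≗g f∈)
  with i , h , h-mono , f≤h ← ⟨SucModExp⟩⇒BoundedByOneArgument f∈ =
  i , h , h-mono , λ v → ≤-trans (≤-reflexive (sym (f≗g v))) (f≤h v)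

-- With the bounding argument held fixed, the sum can be pushed past the bound by the other one,
-- here set to suc (h 0).
addition-unbounded : ¬ BoundedByOneArgument addition
addition-unbounded (zero , h , _ , +≤h) =
  1+n≰n (+≤h (0 ∷ suc (h 0) ∷ []))
addition-unbounded (suc zero , h , _ , +≤h) =
  1+n≰n (≤-trans (m≤m+n (suc (h 0)) 0) (+≤h (suc (h 0) ∷ 0 ∷ [])))

-- On a concrete arity `tabulate` computes to an explicit vector, so this form of substitution holds
-- without `ext`.
apply₂ : ∀ {n} {f : Op 1} {g₀ g₁ : Op n} →
         Elementary f → Elementary g₀ → Elementary g₁ →
         Elementary (λ v → f (g₀ v ∷ g₁ v ∷ []))
apply₂ {g₀ = g₀} {g₁} f∈ g₀∈ g₁∈ =
  subst {g = λ { zero → g₀ ; (suc zero) → g₁ }} f∈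
    λ { zero → g₀∈ ; (suc zero) → g₁∈ }

apply₃ : ∀ {n} {f : Op 2} {g₀ g₁ g₂ : Op n} →
         Elementary f → Elementary g₀ → Elementary g₁ → Elementary g₂ →
         Elementary (λ v → f (g₀ v ∷ g₁ v ∷ g₂ v ∷ []))
apply₃ {g₀ = g₀} {g₁} {g₂} f∈ g₀∈ g₁∈ g₂∈ =
  subst {g = λ { zero → g₀ ; (suc zero) → g₁ ; (suc (suc zero)) → g₂ }} f∈
    λ { zero → g₀∈ ; (suc zero) → g₁∈ ; (suc (suc zero)) → g₂∈ }

sum-constant : ∀ c n → sum (applyUpTo (λ _ → c) n) ≡ n * c
sum-constant c zero    = refl
sum-constant c (suc n) = cong (c +_) (sum-constant c n)

product-constant : ∀ c n → product (applyUpTo (λ _ → c) n) ≡ c ^ n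
product-constant c zero    = refl
product-constant c (suc n) = cong (c *_) (product-constant c n)

sum-indicator : ∀ f {m n} → (∀ {z} → z < m → f z ≡ 1) → (∀ {z} → m ≤ z → f z ≡ 0) →
                m ≤ n → sum (applyUpTo f n) ≡ m
sum-indicator f {zero}  {zero}  _ _ _ = refl
sum-indicator f {zero}  {suc n} _ f≡0 _ =
  cong₂ _+_ (f≡0 z≤n) (sum-indicator (f ∘ suc) {n = n} (λ ()) (λ _ → f≡0 z≤n) z≤n)
sum-indicator f {suc m} {suc n} f≡1 f≡0 (s≤s m≤n) =
  cong₂ _+_ (f≡1 z<s) (sum-indicator (f ∘ suc) (f≡1 ∘ s≤s) (f≡0 ∘ s≤s) m≤n)

m≤n⇒1∸[m∸n]≡1 : ∀ {m n} → m ≤ n → 1 ∸ (m ∸ n) ≡ 1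
m≤n⇒1∸[m∸n]≡1 m≤n = cong (1 ∸_) (m≤n⇒m∸n≡0 m≤n)

m>n⇒1∸[m∸n]≡0 : ∀ {m n} → m > n → 1 ∸ (m ∸ n) ≡ 0
m>n⇒1∸[m∸n]≡0 m>n = m≤n⇒m∸n≡0 (m<n⇒0<n∸m m>n)

-- The number of multiples (z + 1) * y ≤ x with z < x; at y = 0 it is x, not 0.
quotient : Op 1
quotient (x ∷ y ∷ []) = sum (applyUpTo (λ z → 1 ∸ ((z + 1) * y ∸ x)) x)

m*n≤o⇒m≤o/n : ∀ m n o .{{_ : NonZero n}} → m * n ≤ o → m ≤ o / n
m*n≤o⇒m≤o/n m n o m*n≤o =
  ≤-trans (≤-reflexive (sym (m*n/n≡m m n))) (/-monoˡ-≤ n m*n≤o)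

-- For y > 0, (z + 1) * y ≤ x exactly when z < x / y, so the summand is the indicator of an initial
-- segment of length x / y; it fits in the range of summation because x / y ≤ x.
quotient≡/ : ∀ x y .{{_ : NonZero y}} → quotient (x ∷ y ∷ []) ≡ x / y
quotient≡/ x y = sum-indicator _
  (λ {z} z<x/y → m≤n⇒1∸[m∸n]≡1 (≤-trans
    (*-monoˡ-≤ y (≤-trans (≤-reflexive (+-comm z 1)) z<x/y)) (m/n*n≤m x y)))
  (λ {z} x/y≤z → m>n⇒1∸[m∸n]≡0 (≰⇒> λ [z+1]*y≤x → 1+n≰n (≤-trans
    (≤-reflexive (+-comm 1 z)) (≤-trans (m*n≤o⇒m≤o/n (z + 1) y x [z+1]*y≤x) x/y≤z))))
  (m/n≤m x y)

-- The factor y hides the disagreement of the two quotients at y = 0.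
y*quotient≡y*⌊x/y⌋ : ∀ x y → y * quotient (x ∷ y ∷ []) ≡ y * ⌊ x / y ⌋
y*quotient≡y*⌊x/y⌋ x zero    = refl
y*quotient≡y*⌊x/y⌋ x (suc y) = cong (suc y *_) (quotient≡/ x (suc y))

multiplication : Op 1
multiplication (x ∷ y ∷ []) = x * y

successor-elementary : Elementary successor
successor-elementary =
  ext (λ { (x ∷ []) → refl }) (apply₂ add (proj zero) (const 1))

multiplication-elementary : Elementary multiplication
multiplication-elementary =
  ext (λ { (x ∷ y ∷ []) → trans (sum-constant x y) (*-comm y x) }) (bsum (proj zero))

powerOfTwo-elementary : Elementary powerOfTwo
powerOfTwo-elementary = ext (λ { (x ∷ []) → product-constant 2 x }) (bprod (const 2))

quotient-elementary : Elementary quotient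
quotient-elementary =
  ext (λ { (x ∷ y ∷ []) → refl })
    -- x is both a parameter of the summand and the bound, so it is fed twice to a ternary sum.
    (apply₃ (bsum indicator) (proj zero) (proj (suc zero)) (proj zero))
  where
  indicator : Elementary {2} λ v →
    1 ∸ ((lookup v (suc (suc zero)) + 1) * lookup v (suc zero) ∸ lookup v zero)
  indicator =
    apply₂ sub (const 1)
      (apply₂ sub
        (apply₂ multiplication-elementary
          (apply₂ add (proj (suc (suc zero))) (const 1))
          (proj (suc zero)))
        (proj zero))

modulo-elementary : Elementary modulo
modulo-elementary =
  ext (λ { (x ∷ y ∷ []) → cong (x ∸_) (y*quotient≡y*⌊x/y⌋ x y) })
    (apply₂ sub (proj zero)
      (apply₂ multiplication-elementary (proj (suc zero))
        (apply₂ quotient-elementary (proj zero) (proj (suc zero)))))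

⟨SucModExp⟩⊆Elementary : ⟨ SucModExp ⟩ ⊆ Elementary
⟨SucModExp⟩⊆Elementary (base x+1)    = successor-elementary
⟨SucModExp⟩⊆Elementary (base xmody)  = modulo-elementary
⟨SucModExp⟩⊆Elementary (base 2^x)    = powerOfTwo-elementary
⟨SucModExp⟩⊆Elementary (const c)     = const c
⟨SucModExp⟩⊆Elementary (proj i)      = proj i
⟨SucModExp⟩⊆Elementary (subst f∈ g∈) =
  subst (⟨SucModExp⟩⊆Elementary f∈) (λ i → ⟨SucModExp⟩⊆Elementary (g∈ i))
⟨SucModExp⟩⊆Elementary (ext f≗g f∈)  = ext f≗g (⟨SucModExp⟩⊆Elementary f∈)

theorem13 : ⟨ SucModExp ⟩ ⊊ Elementary
theorem13 =
  ⟨SucModExp⟩⊆Elementary ,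
  1 , addition , add , λ +∈ → addition-unbounded (⟨SucModExp⟩⇒BoundedByOneArgument +∈)
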